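{- Let $n\ge 1$ and let $\Pi$ be a triangulation of the once-punctured disc $S_n^1$ with quiddity sequence $q_\Pi=(a_1,a_2,\dots,a_n)$. Then $q_\Pi$ is a quiddity sequence of an infinite frieze $\mathcal{F}_\Pi$ of period $n$; that is, there is an $n$-periodic infinite frieze $\mathcal{F}_\Pi=(m_{ij})_{j-i\ge -2}$ with $m_{ii}=a_i$ for all $i\in\{1,\dots,n\}$.
   Context: Infinite friezes: an infinite frieze is an array $(m_{ij})_{i,j\in\mathbb{Z},\,j-i\ge -2}$ of integers with $m_{i,i-2}=0$ and $m_{i,i-1}=1$ for all $i\in\mathbb{Z}$, $m_{ij}>0$ for all $j\ge i$, and $m_{ij}m_{i+1,j+1}-m_{i+1,j}m_{i,j+1}=1$ for all $j-i\ge -1$. It is $n$-periodic (of period $n$; $n$ need not be minimal) if $m_{ij}=m_{i+n,j+n}$ for all $i\le j$. The quiddity sequence of an $n$-periodic infinite frieze is the $n$-tuple $(m_{11},\dots,m_{nn})$, determined up to cyclic equivalence. Triangulations: for $n\ge 1$, $S_n^1$ is a closed disc with $n$ marked points on the boundary, labeled $1,2,\dots,n$ in clockwise order, and one marked point in the interior, the puncture, labeled $0$. An arc in $S_n^1$ is (the isotopy class of) a non-self-intersecting curve connecting two marked points (possibly equal, in which case it is a loop) which is non-boundary, i.e. not isotopic to a boundary segment between neighboring marked points. The arcs are: the bridging arcs $0j$ connecting the puncture with the boundary marked point $j$; and the peripheral arcs $ij$ ($i,j$ boundary marked points, $i=j$ allowed), where $ij$ is the arc isotopic to the boundary segment going clockwise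 from $i$ to $j$ when all marked points on the boundary other than $i$ and $j$ are ignored. Two arcs are non-crossing if they do not meet in the interior of $S_n^1$ (away from the puncture). A triangulation $\Pi$ of $S_n^1$ is a maximal collection of pairwise non-crossing arcs; it has exactly $n$ arcs and cuts $S_n^1$ into $n$ regions called triangles. The quiddity sequence of $\Pi$ is $q_\Pi=(a_1,\dots,a_n)$, where $a_i$ is the number of connected components of $(S_n^1\setminus\Pi)\cap U$ for $U$ a small neighborhood of the boundary marked point $i$. -}

module Defs where

open import Data.Bool using (if_then_else_)
open import Data.Empty using (⊥)
open import Data.Fin using (Fin; toℕ; _≟_)
open import Data.Integer as ℤ using (ℤ; +_; 0ℤ; 1ℤ)
open import Data.List using (List; map; sum)
open import Data.List.Membership.Propositional using (_∈_)
open import Data.List.Relation.Binary.Subset.Propositional using (_⊆_)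
open import Data.List.Relation.Unary.Unique.Propositional using (Unique)
open import Data.Nat using (ℕ; suc; _+_; _∸_; _≤_; _<_; _<ᵇ_)
open import Data.Product using (_×_)
open import Data.Sum using (_⊎_)
open import Relation.Binary.PropositionalEquality using (_≡_)
open import Relation.Nullary using (¬_; does)

-- The array is indexed by the pairs (i , j) with j - i ≥ -2; the values of
-- the total function m elsewhere carry no information.
record IsInfiniteFrieze (m : ℤ → ℤ → ℤ) : Set where
  field
    zeros    : ∀ i → m i (i ℤ.- + 2) ≡ 0ℤ
    ones     : ∀ i → m i (i ℤ.- + 1) ≡ 1ℤ
    positive : ∀ i j → i ℤ.≤ j → 0ℤ ℤ.< m i j
    diamond  : ∀ i j → ℤ.- (+ 1) ℤ.≤ j ℤ.- i →
               m i j ℤ.* m (i ℤ.+ + 1) (j ℤ.+ + 1)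
                 ℤ.- m (i ℤ.+ + 1) j ℤ.* m i (j ℤ.+ + 1) ≡ 1ℤ

IsPeriodic : ℕ → (ℤ → ℤ → ℤ) → Set
IsPeriodic n m = ∀ i j → i ℤ.≤ j → m i j ≡ m (i ℤ.+ + n) (j ℤ.+ + n)

-- The boundary marked points 1, …, n, in clockwise order, are the elements
-- of Fin n, shifted by one.
label : ∀ {n} → Fin n → ℤ
label i = + suc (toℕ i)

-- The number of boundary steps going clockwise from i to j, between 1 and n;
-- a full turn, of length n, if i = j.
cw : ∀ {n} → Fin n → Fin n → ℕ
cw {n} i j =
  if toℕ i <ᵇ toℕ j then toℕ j ∸ toℕ i else (n + toℕ j) ∸ toℕ i

-- Isotopy classes of arcs of the once-punctured disc.  The peripheral curve
-- i j is parallel to the boundary path going clockwise from i to j, with the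
-- puncture on its other side, so it is isotopic to a boundary segment exactly
-- when this path has length 1.  For i = j it is the loop around the puncture,
-- which is a boundary segment exactly when n = 1.
data Arc (n : ℕ) : Set where
  bridging   : Fin n → Arc n
  peripheral : (i j : Fin n) → .(2 ≤ cw i j) → Arc n

-- Two classes of arcs have disjoint representatives (away from marked points)
-- iff no lifts of them cross in the universal cover of the disc minus the
-- puncture.  That cover is a half-plane with the marked points lifted to the
-- integers on its boundary line.  The lifts of the peripheral arc i j are the
-- chords from x to x + cw i j with x over i, and the lifts of the bridging arc
-- at k are the rays going off to infinity from the points over k.

-- Some lift of i j, from a to b, and some lift of k l, from c to d,
-- satisfy a < c < b < d.
Overtakes : ∀ {n} → (i j k l : Fin n) → Set
Overtakes i j k l = cw i k < cw i j × cw i j < cw i k + cw k l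

Crosses : ∀ {n} → Arc n → Arc n → Set
Crosses (bridging _)       (bridging _)       = ⊥
Crosses (bridging k)       (peripheral i j _) = cw i k < cw i j
Crosses (peripheral i j _) (bridging k)       = cw i k < cw i j
Crosses (peripheral i j _) (peripheral k l _) = Overtakes i j k l ⊎ Overtakes k l i j

NonCrossing : ∀ {n} → List (Arc n) → Set
NonCrossing Π = ∀ {α β} → α ∈ Π → β ∈ Π → ¬ Crosses α β

record IsTriangulation {n : ℕ} (Π : List (Arc n)) : Set where
  field
    unique      : Unique Π
    nonCrossing : NonCrossing Π
    maximal     : ∀ {Γ} → NonCrossing Γ → Π ⊆ Γ → Γ ⊆ Π

δ : ∀ {n} → Fin n → Fin n → ℕ
δ i j = if does (i ≟ j) then 1 else 0

-- The number of ends of an arc at i; a loop based at i has two.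
ends : ∀ {n} → Fin n → Arc n → ℕ
ends i (bridging j)       = δ i j
ends i (peripheral j k _) = δ i j + δ i k

-- A small neighbourhood of the boundary point i is a half-disc, which e arc
-- ends emanating from i cut into e + 1 connected components.
quiddity : ∀ {n} → List (Arc n) → Fin n → ℕ
quiddity Π i = suc (sum (map (ends i) Π))

{-# OPTIONS --safe #-}

-- The quiddity sequence a, extended periodically, determines the array by the
-- recurrence u (k + 1) = a k u k - u (k - 1) along rows; the diamond rule is
-- the constancy of a Wronskian, so only positivity is at stake.  By Sturm
-- comparison it suffices to find positive values v at the boundary points of
-- the universal cover with v (k - 1) + v (k + 1) ≤ a k v k.  Put v = 1 at the
-- ends of bridging arcs and, recursively, v k = v i + v j at the third vertex k
-- of the triangle below an arc i j, as in Conway and Coxeter's labelling.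
-- Telescoping over the fan of triangles at k gives the inequality (in fact an
-- equality, but only the lower bound on the number of arc ends is needed).
module Submission where

open import Data.Bool using (true; false; if_then_else_)
open import Data.Empty using (⊥; ⊥-elim)
open import Data.Fin as Fin using (Fin; toℕ)
import Data.Fin.Properties as Fin
open import Data.Integer as ℤ using (ℤ; +_; -[1+_]; 0ℤ; 1ℤ; ∣_∣)
import Data.Integer.Properties as ℤ
import Data.Integer.Tactic.RingSolver as ℤ-Ring
open import Data.List using (List; []; _∷_; map)
open import Data.List.Extrema.Nat using (argmax; argmax-sel; f[xs]≤f[argmax])
open import Data.List.Membership.Propositional using (_∈_)
import Data.List.Membership.DecPropositional as DecMembership
import Data.List.Relation.Unary.All as All
open import Data.List.Relation.Unary.Any using (here; there)
open import Data.Nat using (ℕ; zero; suc; _+_; _*_; _∸_; _≤_; _<_; _%_; z≤n; s≤s; s≤s⁻¹;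
  _≤ᵇ_; _<ᵇ_; _≟_; _≤?_; _<?_)
open import Data.Nat.DivMod using (_mod_; %-distribˡ-+; [m+n]%n≡m%n; [m+kn]%n≡m%n; m%n%n≡m%n;
  m≤n⇒m%n≡m; m<n⇒m%n≡m)
open import Data.Nat.ListAction using (sum)
open import Data.Nat.Properties
open import Data.Nat.Tactic.RingSolver using (solve-∀)
open import Data.Product using (Σ; ∃; ∃₂; _×_; _,_; proj₂)
open import Data.Sum using (_⊎_; inj₁; inj₂; swap)
open import Relation.Binary using (DecidableEquality; tri<; tri≈; tri>)
open import Relation.Binary.PropositionalEquality
open import Relation.Nullary using (¬_; Dec; yes; no; recompute; contradiction)
open import Relation.Nullary.Decidable using (_×-dec_; _⊎-dec_; map′; dec-true)
open import Defs

-- Supersolutions and Sturm comparison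

-- Path x A A′ y B′ B: positive values A, A′, …, B′, B at the positions
-- x, x + 1, …, y - 1, y which form a supersolution of the recurrence
-- v (k - 1) + v (k + 1) = a k * v k.
data Path (a : ℕ → ℕ) : (x A A′ y B′ B : ℕ) → Set where
  edge : ∀ {x A B} → 0 < A → 0 < B → Path a x A B (suc x) A B
  cons : ∀ {x A B C y D E} → 0 < A → A + C ≤ a (suc x) * B →
         Path a (suc x) B C y D E → Path a x A B y D E

module _ {a : ℕ → ℕ} where

  -- Only the inequality at the joint `k` is new. It involves the neighbouring values `P` and `Q`,
  -- which is why a path carries its second and second-to-last values as indices.
  glue : ∀ {x A A′ k P M Q y B′ B} → Path a x A A′ k P M → Path a k M Q y B′ B →
         P + Q ≤ a k * M → Path a x A A′ y B′ B
  glue (edge A>0 _)   q h = cons A>0 h q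
  glue (cons A>0 i p) q h = cons A>0 i (glue p q h)

  head-positive : ∀ {x A A′ y B′ B} → Path a x A A′ y B′ B → 0 < A
  head-positive (edge A>0 _)   = A>0
  head-positive (cons A>0 _ _) = A>0

  drop : ∀ {x A A′ y B′ B} k → k + x < y → Path a x A A′ y B′ B →
         ∃₂ λ C C′ → Path a (k + x) C C′ y B′ B
  drop zero    _   p            = _ , _ , p
  drop {x} (suc k) k+x<y (edge _ _) =
    ⊥-elim (<⇒≱ k+x<y (s≤s (m≤n+m x k)))
  drop {x} {y = y} {B′} {B} (suc k) k+x<y (cons _ _ p) =
    subst (λ z → ∃₂ λ C C′ → Path a z C C′ y B′ B) (+-suc k x)
      (drop k (subst (_< y) (sym (+-suc k x)) k+x<y) p)

  -- Sturm comparison: the Wronskian of a solution f and a positive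
  -- supersolution does not decrease as long as f is positive.
  solution-positive : ∀ {x A A′ y B′ B} → Path a x A A′ y B′ B → (f : ℕ → ℤ) →
    (∀ t → f (2 + t) ≡ + a (suc (x + t)) ℤ.* f (suc t) ℤ.- f t) →
    0ℤ ℤ.≤ f 0 → f 0 ℤ.* + A′ ℤ.< f 1 ℤ.* + A →
    ∀ t → x + suc t ≤ y → 0ℤ ℤ.< f (suc t)
  solution-positive {x} {A} {A′} {y} p f rec f₀≥0 W>0 = go p
    where
    f₁>0 : 0ℤ ℤ.< f 1
    f₁>0 = ℤ.*-cancelʳ-<-nonNeg {0ℤ} {f 1} (+ A)
      (ℤ.≤-<-trans (ℤ.*-monoʳ-≤-nonNeg (+ A′) {0ℤ} {f 0} f₀≥0) W>0)

    go : ∀ {B′ B} → Path a x A A′ y B′ B → ∀ t → x + suc t ≤ y → 0ℤ ℤ.< f (suc t)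
    go _ zero _ = f₁>0
    go (edge _ _) (suc t) h =
      ⊥-elim (<⇒≱ (m<m+n x (s≤s (z≤n {t})))
        (≤-pred (subst (_≤ suc x) (+-suc x (suc t)) h)))
    go (cons {C = C} _ A+C≤aA′ q) (suc t) h =
      solution-positive q (λ t → f (suc t)) rec′ (ℤ.<⇒≤ f₁>0) W′>0 t
        (subst (_≤ y) (+-suc x (suc t)) h)
      where
      rec′ : ∀ t → f (3 + t) ≡ + a (suc (suc x + t)) ℤ.* f (2 + t) ℤ.- f (suc t)
      rec′ t = trans (rec (suc t))
        (cong (λ z → + a (suc z) ℤ.* f (2 + t) ℤ.- f (suc t)) (+-suc x t))

      -- The defect of the supersolution at `suc x`. Passing to the next position adds `f 1 * slack`
      -- to the Wronskian.
      slack : ℕ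
      slack = a (suc x) * A′ ∸ (A + C)

      slack-eq : + a (suc x) ℤ.* + A′ ≡ + A ℤ.+ + C ℤ.+ + slack
      slack-eq = trans (sym (ℤ.pos-* (a (suc x)) A′))
        (cong +_ (sym (m+[n∸m]≡n A+C≤aA′)))

      f₂-eq : f 2 ≡ + a (suc x) ℤ.* f 1 ℤ.- f 0
      f₂-eq = trans (rec 0) (cong (λ z → + a (suc z) ℤ.* f 1 ℤ.- f 0) (+-identityʳ x))

      W-W>0 : 0ℤ ℤ.< f 1 ℤ.* + A ℤ.- f 0 ℤ.* + A′
      W-W>0 = subst (ℤ._< f 1 ℤ.* + A ℤ.- f 0 ℤ.* + A′) (ℤ.+-inverseʳ (f 0 ℤ.* + A′))
        (ℤ.+-monoˡ-< (ℤ.- (f 0 ℤ.* + A′)) W>0)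

      expand : ∀ α u v b → (α ℤ.* u ℤ.- v) ℤ.* b ≡ (α ℤ.* b) ℤ.* u ℤ.- v ℤ.* b
      expand = ℤ-Ring.solve-∀

      collect : ∀ A C s u v b → (A ℤ.+ C ℤ.+ s) ℤ.* u ℤ.- v ℤ.* b ≡
                u ℤ.* C ℤ.+ (u ℤ.* A ℤ.- v ℤ.* b ℤ.+ u ℤ.* s)
      collect = ℤ-Ring.solve-∀

      W′>0 : f 1 ℤ.* + C ℤ.< f 2 ℤ.* + A′
      W′>0 = begin-strict
        f 1 ℤ.* + C ≡⟨ ℤ.+-identityʳ _ ⟨
        f 1 ℤ.* + C ℤ.+ 0ℤ
          <⟨ ℤ.+-monoʳ-< (f 1 ℤ.* + C)
               (ℤ.+-mono-<-≤ W-W>0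
                 (ℤ.*-monoʳ-≤-nonNeg (+ slack) (ℤ.<⇒≤ f₁>0))) ⟩
        f 1 ℤ.* + C ℤ.+ (f 1 ℤ.* + A ℤ.- f 0 ℤ.* + A′ ℤ.+ f 1 ℤ.* + slack)
          ≡⟨ collect (+ A) (+ C) (+ slack) (f 1) (f 0) (+ A′) ⟨
        (+ A ℤ.+ + C ℤ.+ + slack) ℤ.* f 1 ℤ.- f 0 ℤ.* + A′
          ≡⟨ cong (λ z → z ℤ.* f 1 ℤ.- f 0 ℤ.* + A′) slack-eq ⟨
        (+ a (suc x) ℤ.* + A′) ℤ.* f 1 ℤ.- f 0 ℤ.* + A′
          ≡⟨ expand (+ a (suc x)) (f 1) (f 0) (+ A′) ⟨
        (+ a (suc x) ℤ.* f 1 ℤ.- f 0) ℤ.* + A′ ≡⟨ cong (ℤ._* + A′) f₂-eq ⟨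
        f 2 ℤ.* + A′ ∎
        where open ℤ.≤-Reasoning

-- Continuants

module Continuant (a : ℕ → ℕ) where

  -- The entry m r (r + t - 2) of the array with diagonal a.
  U : ℕ → ℕ → ℤ
  U r 0             = 0ℤ
  U r 1             = 1ℤ
  U r (suc (suc t)) = + a (r + t) ℤ.* U r (suc t) ℤ.- U r t

  U-diag : ∀ r → U r 2 ≡ + a r
  U-diag r = trans (lemma (+ a (r + 0))) (cong (λ z → + a z) (+-identityʳ r))
    where
    lemma : ∀ x → x ℤ.* 1ℤ ℤ.- 0ℤ ≡ x
    lemma = ℤ-Ring.solve-∀

  -- `U r` read from index 1 and `U (suc r)` read from index 0 obey the same recurrence, so their
  -- Wronskian keeps its value at `t = 0`.
  U-diamond : ∀ r t → U r (suc t) ℤ.* U (suc r) (suc t) ℤ.- U (suc r) t ℤ.* U r (2 + t) ≡ 1ℤ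
  U-diamond r zero    = refl
  U-diamond r (suc t) = trans
    (cong (λ z → U r (2 + t) ℤ.* (+ a z ℤ.* U (suc r) (suc t) ℤ.- U (suc r) t)
                 ℤ.- U (suc r) (suc t) ℤ.* U r (3 + t)) (sym (+-suc r t)))
    (trans (lemma (+ a (r + suc t)) (U r (suc t)) (U r (2 + t)) (U (suc r) t) (U (suc r) (suc t)))
           (U-diamond r t))
    where
    lemma : ∀ α p q s u → q ℤ.* (α ℤ.* u ℤ.- s) ℤ.- u ℤ.* (α ℤ.* q ℤ.- p) ≡ p ℤ.* u ℤ.- s ℤ.* q
    lemma = ℤ-Ring.solve-∀

  -- The row starts with 0, 1, so its initial Wronskian against the path is `A`, which is positive.
  U-positive : ∀ {x A A′ y B′ B} → Path a x A A′ y B′ B →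
    ∀ t → x + suc t ≤ y → 0ℤ ℤ.< U (suc x) (suc t)
  U-positive {A = A} p = solution-positive p (U _) (λ _ → refl) ℤ.≤-refl
    (subst (0ℤ ℤ.<_) (sym (ℤ.*-identityˡ (+ A))) (ℤ.+<+ (head-positive p)))

-- Residues modulo `n`

module Residues (n′ : ℕ) where

  n : ℕ
  n = suc n′

  +-congʳ-% : ∀ r s t → r % n ≡ s % n → (r + t) % n ≡ (s + t) % n
  +-congʳ-% r s t eq = begin
    (r + t) % n         ≡⟨ %-distribˡ-+ r t n ⟩
    (r % n + t % n) % n ≡⟨ cong (λ z → (z + t % n) % n) eq ⟩
    (s % n + t % n) % n ≡⟨ %-distribˡ-+ s t n ⟨
    (s + t) % n         ∎
    where open ≡-Reasoning

  +-cancelʳ-% : ∀ r s {t} → t ≤ n → (r + t) % n ≡ (s + t) % n → r % n ≡ s % n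
  +-cancelʳ-% r s {t} t≤n eq =
    trans (sym (full-turn r)) (trans (+-congʳ-% (r + t) (s + t) (n ∸ t) eq) (full-turn s))
    where
    full-turn : ∀ r → (r + t + (n ∸ t)) % n ≡ r % n
    full-turn r = trans (cong (_% n) (trans (+-assoc r t (n ∸ t)) (cong (_+_ r) (m+[n∸m]≡n t≤n))))
      ([m+n]%n≡m%n r n)

-- The periodic array over the integers

module PeriodicFrieze (n′ : ℕ) (a : ℕ → ℕ)
  (a-cong : ∀ r s → r % suc n′ ≡ s % suc n′ → a r ≡ a s) where

  open Continuant a
  open Residues n′

  U-cong : ∀ r s t → r % n ≡ s % n → U r t ≡ U s t
  U-cong r s zero          eq = refl
  U-cong r s (suc zero)    eq = refl
  U-cong r s (suc (suc t)) eq = cong₂ ℤ._-_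
    (cong₂ ℤ._*_ (cong +_ (a-cong (r + t) (s + t) (+-congʳ-% r s t eq)))
                 (U-cong r s (suc t) eq))
    (U-cong r s t eq)

  -- Congruent to i modulo n, because - (k + 1) ≡ (k + 1) (n - 1).
  residue : ℤ → ℕ
  residue (+ k)    = k
  residue -[1+ k ] = suc k * n′

  residue-suc : ∀ i → residue (i ℤ.+ + 1) % n ≡ suc (residue i) % n
  residue-suc (+ k) = cong (_% n) (+-comm k 1)
  residue-suc -[1+ 0 ] = sym (begin
    suc (n′ + 0) % n ≡⟨ cong (λ z → suc z % n) (+-identityʳ n′) ⟩
    n % n            ≡⟨ [m+n]%n≡m%n 0 n ⟩
    0 % n            ∎)
    where open ≡-Reasoning
  residue-suc -[1+ suc k ] = sym (begin
    suc (n′ + suc k * n′) % n ≡⟨ cong (_% n) (+-comm n (suc k * n′)) ⟩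
    (suc k * n′ + n) % n      ≡⟨ [m+n]%n≡m%n (suc k * n′) n ⟩
    suc k * n′ % n            ∎)
    where open ≡-Reasoning

  residue-+ : ∀ i k → residue (i ℤ.+ + k) % n ≡ (residue i + k) % n
  residue-+ i zero = cong (_% n)
    (trans (cong residue (ℤ.+-identityʳ i)) (sym (+-identityʳ (residue i))))
  residue-+ i (suc k) = begin
    residue (i ℤ.+ + suc k) % n         ≡⟨ cong (λ z → residue z % n) (shift i (+ k)) ⟩
    residue (i ℤ.+ + k ℤ.+ + 1) % n     ≡⟨ residue-suc (i ℤ.+ + k) ⟩
    suc (residue (i ℤ.+ + k)) % n       ≡⟨ cong (_% n) (+-comm 1 _) ⟩
    (residue (i ℤ.+ + k) + 1) % n       ≡⟨ +-congʳ-% (residue (i ℤ.+ + k)) (residue i + k) 1 (residue-+ i k) ⟩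
    (residue i + k + 1) % n             ≡⟨ cong (_% n) (trans (+-assoc (residue i) k 1)
                                             (cong (_+_ (residue i)) (+-comm k 1))) ⟩
    (residue i + suc k) % n             ∎
    where
    open ≡-Reasoning
    shift : ∀ i k → i ℤ.+ (1ℤ ℤ.+ k) ≡ i ℤ.+ k ℤ.+ 1ℤ
    shift = ℤ-Ring.solve-∀

  -- a is indexed from 0 while the boundary points are labelled from 1, so
  -- row i of the array starts at the residue of i - 1.
  row : ℤ → ℕ
  row i = residue i + n′

  row-suc : ∀ i → row (i ℤ.+ + 1) % n ≡ suc (row i) % n
  row-suc i = +-congʳ-% (residue (i ℤ.+ + 1)) (suc (residue i)) n′ (residue-suc i)

  row-+n : ∀ i → row (i ℤ.+ + n) % n ≡ row i % n
  row-+n i = +-congʳ-% (residue (i ℤ.+ + n)) (residue i) n′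
    (trans (residue-+ i n) ([m+n]%n≡m%n (residue i) n))

  -- On the index range `j - i + 2` is nonnegative, so the absolute value merely turns the offset
  -- within row `i` into a natural number.
  frieze : ℤ → ℤ → ℤ
  frieze i j = U (row i) ∣ j ℤ.- i ℤ.+ + 2 ∣

  frieze-periodic : IsPeriodic n frieze
  frieze-periodic i j _ = trans (U-cong (row i) (row (i ℤ.+ + n)) ∣ j ℤ.- i ℤ.+ + 2 ∣ (sym (row-+n i)))
    (cong (λ z → U (row (i ℤ.+ + n)) ∣ z ∣) (shift i j (+ n)))
    where
    shift : ∀ i j k → j ℤ.- i ℤ.+ + 2 ≡ (j ℤ.+ k) ℤ.- (i ℤ.+ k) ℤ.+ + 2
    shift = ℤ-Ring.solve-∀

  frieze-diag : ∀ k → frieze (+ suc k) (+ suc k) ≡ + a k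
  frieze-diag k = begin
    U (suc k + n′) ∣ + suc k ℤ.- + suc k ℤ.+ + 2 ∣
      ≡⟨ cong (λ z → U (suc k + n′) ∣ z ℤ.+ + 2 ∣) (ℤ.+-inverseʳ (+ suc k)) ⟩
    -- `suc k + n′` is `k + n`: the shift in `row` undoes the shift of the labels.
    U (suc k + n′) 2  ≡⟨ U-cong (suc k + n′) k 2
           (trans (cong (_% n) (sym (+-suc k n′))) ([m+n]%n≡m%n k n)) ⟩
    U k 2             ≡⟨ U-diag k ⟩
    + a k             ∎
    where open ≡-Reasoning

  frieze-isFrieze : (∀ r t → 0ℤ ℤ.< U r (suc t)) → IsInfiniteFrieze frieze
  frieze-isFrieze U>0 = record
    { zeros = λ i → cong (λ z → U (row i) ∣ z ∣) (zero-eq i)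
    ; ones  = λ i → cong (λ z → U (row i) ∣ z ∣) (one-eq i)
    ; positive = λ i j i≤j → subst (λ z → 0ℤ ℤ.< U (row i) ∣ z ℤ.+ + 2 ∣)
        (ℤ.0≤i⇒+∣i∣≡i (ℤ.i≤j⇒0≤j-i i≤j))
        (subst (λ z → 0ℤ ℤ.< U (row i) z) (+-comm 2 ∣ j ℤ.- i ∣) (U>0 (row i) _))
    ; diamond = diamond′
    }
    where
    zero-eq : ∀ i → (i ℤ.- + 2) ℤ.- i ℤ.+ + 2 ≡ 0ℤ
    zero-eq = ℤ-Ring.solve-∀
    one-eq : ∀ i → (i ℤ.- + 1) ℤ.- i ℤ.+ + 2 ≡ 1ℤ
    one-eq = ℤ-Ring.solve-∀
    diamond′ : ∀ i j → ℤ.- (+ 1) ℤ.≤ j ℤ.- i →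
      frieze i j ℤ.* frieze (i ℤ.+ + 1) (j ℤ.+ + 1)
        ℤ.- frieze (i ℤ.+ + 1) j ℤ.* frieze i (j ℤ.+ + 1) ≡ 1ℤ
    diamond′ i j h = begin
      frieze i j ℤ.* frieze (i ℤ.+ + 1) (j ℤ.+ + 1)
        ℤ.- frieze (i ℤ.+ + 1) j ℤ.* frieze i (j ℤ.+ + 1)
          ≡⟨ cong₂ ℤ._-_ (cong₂ ℤ._*_ (entry 1 (e₁ i j)) (next 1 (e₂ i j)))
                         (cong₂ ℤ._*_ (next 0 (e₃ i j)) (entry 2 (e₄ i j))) ⟩
      U r (suc t) ℤ.* U (suc r) (suc t) ℤ.- U (suc r) t ℤ.* U r (2 + t)
          ≡⟨ U-diamond r t ⟩
      1ℤ ∎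
      where
      open ≡-Reasoning
      -- By `h` the integer `j - i + 1` is nonnegative, so `t` represents it faithfully; the four
      -- entries sit at offsets `1 + t`, `1 + t`, `t` and `2 + t`.
      r t : ℕ
      r = row i
      t = ∣ j ℤ.- i ℤ.+ + 1 ∣
      t-eq : + t ≡ j ℤ.- i ℤ.+ + 1
      t-eq = ℤ.0≤i⇒+∣i∣≡i (ℤ.+-monoˡ-≤ (+ 1) h)
      entry : ∀ {z s} k → z ≡ + k ℤ.+ (j ℤ.- i ℤ.+ + 1) → U s ∣ z ∣ ≡ U s (k + t)
      entry {s = s} k eq = cong (λ z → U s ∣ z ∣) (trans eq (cong (ℤ._+_ (+ k)) (sym t-eq)))
      next : ∀ {z} k → z ≡ + k ℤ.+ (j ℤ.- i ℤ.+ + 1) → U (row (i ℤ.+ + 1)) ∣ z ∣ ≡ U (suc r) (k + t)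
      next k eq = trans (entry k eq) (U-cong (row (i ℤ.+ + 1)) (suc r) (k + t) (row-suc i))
      e₁ : ∀ i j → j ℤ.- i ℤ.+ + 2 ≡ + 1 ℤ.+ (j ℤ.- i ℤ.+ + 1)
      e₁ = ℤ-Ring.solve-∀
      e₂ : ∀ i j → (j ℤ.+ + 1) ℤ.- (i ℤ.+ + 1) ℤ.+ + 2 ≡ + 1 ℤ.+ (j ℤ.- i ℤ.+ + 1)
      e₂ = ℤ-Ring.solve-∀
      e₃ : ∀ i j → j ℤ.- (i ℤ.+ + 1) ℤ.+ + 2 ≡ + 0 ℤ.+ (j ℤ.- i ℤ.+ + 1)
      e₃ = ℤ-Ring.solve-∀
      e₄ : ∀ i j → (j ℤ.+ + 1) ℤ.- i ℤ.+ + 2 ≡ + 2 ℤ.+ (j ℤ.- i ℤ.+ + 1)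
      e₄ = ℤ-Ring.solve-∀

-- Subtraction, bounded search and finite sums

∸-telescope : ∀ {a c d} → a ≤ c → c ≤ d → (c ∸ a) + (d ∸ c) ≡ d ∸ a
∸-telescope {a} a≤c c≤d with m≤n⇒∃[o]m+o≡n a≤c | m≤n⇒∃[o]m+o≡n c≤d
... | u , refl | v , refl = begin
  (a + u ∸ a) + (a + u + v ∸ (a + u)) ≡⟨ cong₂ _+_ (m+n∸m≡n a u) (m+n∸m≡n (a + u) v) ⟩
  u + v                               ≡⟨ m+n∸m≡n a (u + v) ⟨
  a + (u + v) ∸ a                     ≡⟨ cong (_∸ a) (+-assoc a u v) ⟨
  a + u + v ∸ a                       ∎
  where open ≡-Reasoning

∸-reflect-< : ∀ o {m n} → m ∸ o < n ∸ o → m < n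
∸-reflect-< o h = ≰⇒> λ n≤m → <⇒≱ h (∸-monoˡ-≤ o n≤m)

module _ {P : ℕ → Set} (P? : ∀ k → Dec (P k)) where

  -- A scan upwards from `lo` with `d` as fuel; the witness at the top end `d + lo` guarantees that
  -- it succeeds.
  least : ∀ d lo → P (d + lo) →
    ∃ λ k → lo ≤ k × k ≤ d + lo × P k × (∀ {j} → lo ≤ j → j < k → ¬ P j)
  least d lo Phi with P? lo
  ... | yes Plo = lo , ≤-refl , m≤n+m lo d , Plo , λ lo≤j j<lo _ → <⇒≱ j<lo lo≤j
  least zero    lo Phi | no ¬Plo = contradiction Phi ¬Plo
  least (suc d) lo Phi | no ¬Plo
    with k , lo<k , k≤hi , Pk , min ← least d (suc lo) (subst P (sym (+-suc d lo)) Phi) =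
    k , <⇒≤ lo<k , subst (k ≤_) (+-suc d lo) k≤hi , Pk , λ lo≤j j<k Pj →
      case-split (m≤n⇒m<n∨m≡n lo≤j) j<k Pj min
    where
    case-split : ∀ {j k} → lo < j ⊎ lo ≡ j → j < k → P j →
      (∀ {j} → suc lo ≤ j → j < k → ¬ P j) → ⊥
    case-split (inj₁ lo<j) j<k Pj min = min lo<j j<k Pj
    case-split (inj₂ refl) _   Pj _   = ¬Plo Pj

module _ {A : Set} where

  sum-mono-≤ : {f g : A → ℕ} → (∀ α → f α ≤ g α) → ∀ xs → sum (map f xs) ≤ sum (map g xs)
  sum-mono-≤ f≤g []       = z≤n
  sum-mono-≤ f≤g (α ∷ xs) = +-mono-≤ (f≤g α) (sum-mono-≤ f≤g xs)

  sum-mono-< : {f g : A → ℕ} → (∀ α → f α ≤ g α) →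
    ∀ {α xs} → α ∈ xs → f α < g α → sum (map f xs) < sum (map g xs)
  sum-mono-< f≤g {xs = _ ∷ xs} (here refl) f<g = +-mono-<-≤ f<g (sum-mono-≤ f≤g xs)
  sum-mono-< f≤g (there α∈xs) f<g = +-mono-≤-< (f≤g _) (sum-mono-< f≤g α∈xs f<g)

  sum-map-+ : (f g : A → ℕ) → ∀ xs →
    sum (map f xs) + sum (map g xs) ≡ sum (map (λ α → f α + g α) xs)
  sum-map-+ f g []       = refl
  sum-map-+ f g (α ∷ xs) = trans (interchange (f α) (sum (map f xs)) (g α) (sum (map g xs)))
    (cong (_+_ (f α + g α)) (sum-map-+ f g xs))
    where
    interchange : ∀ a b c d → (a + b) + (c + d) ≡ (a + c) + (b + d)
    interchange = solve-∀

-- Counting arc ends by length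

δ-refl : ∀ {n} (i : Fin n) → δ i i ≡ 1
δ-refl i rewrite dec-true (i Fin.≟ i) refl = refl

capped : ℕ → ℕ → ℕ → ℕ
capped l c w = if c ≤ᵇ l then w else 0

capped-≤ : ∀ {l c} w → c ≤ l → capped l c w ≡ w
capped-≤ {l} {c} w c≤l with c ≤ᵇ l | ≤⇒≤ᵇ c≤l
... | true | _ = refl

capped-> : ∀ {l c} w → l < c → capped l c w ≡ 0
capped-> {l} {c} w l<c with c ≤ᵇ l | ≤ᵇ⇒≤ c l
... | true  | f = contradiction (f _) (<⇒≱ l<c)
... | false | _ = refl

capped≤ : ∀ l c w → capped l c w ≤ w
capped≤ l c w with c ≤ᵇ l
... | true  = ≤-refl
... | false = z≤n

capped-mono : ∀ {l m} c w → l ≤ m → capped l c w ≤ capped m c w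
capped-mono {l} {m} c w l≤m with c ≤? l
... | yes c≤l = ≤-trans (capped≤ l c w) (≤-reflexive (sym (capped-≤ w (≤-trans c≤l l≤m))))
... | no c≰l  = ≤-trans (≤-reflexive (capped-> w (≰⇒> c≰l))) z≤n

-- Bridging arcs count as zero, which leaves their ends free to supply the extra unit needed at a
-- bridging vertex.
startsIn endsIn : ∀ {n} → Fin n → ℕ → Arc n → ℕ
startsIn i l (bridging _)       = 0
startsIn i l (peripheral j k _) = capped l (cw j k) (δ i j)
endsIn i l (bridging _)         = 0
endsIn i l (peripheral j k _)   = capped l (cw j k) (δ i k)

startsIn-mono : ∀ {n} (i : Fin n) {l m} → l ≤ m → ∀ α → startsIn i l α ≤ startsIn i m α
startsIn-mono i l≤m (bridging _)       = z≤n
startsIn-mono i l≤m (peripheral j k _) = capped-mono (cw j k) (δ i j) l≤m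

endsIn-mono : ∀ {n} (i : Fin n) {l m} → l ≤ m → ∀ α → endsIn i l α ≤ endsIn i m α
endsIn-mono i l≤m (bridging _)       = z≤n
endsIn-mono i l≤m (peripheral j k _) = capped-mono (cw j k) (δ i k) l≤m

-- The two cutoffs are independent because the edges on the two sides of a vertex may differ in
-- length.
startsIn+endsIn≤ends : ∀ {n} (i : Fin n) l m α → startsIn i l α + endsIn i m α ≤ ends i α
startsIn+endsIn≤ends i l m (bridging _)       = z≤n
startsIn+endsIn≤ends i l m (peripheral j k _) =
  +-mono-≤ (capped≤ l (cw j k) (δ i j)) (capped≤ m (cw j k) (δ i k))

_≟ᴬ_ : ∀ {n} → DecidableEquality (Arc n)
bridging i ≟ᴬ bridging j = map′ (λ { refl → refl }) (λ { refl → refl }) (i Fin.≟ j)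
bridging _ ≟ᴬ peripheral _ _ _ = no λ ()
peripheral _ _ _ ≟ᴬ bridging _ = no λ ()
peripheral i j _ ≟ᴬ peripheral k l _ =
  map′ (λ { (refl , refl) → refl }) (λ { refl → refl , refl }) (i Fin.≟ k ×-dec j Fin.≟ l)

Crosses-sym : ∀ {n} (α β : Arc n) → Crosses α β → Crosses β α
Crosses-sym (bridging _)       (peripheral _ _ _) c = c
Crosses-sym (peripheral _ _ _) (bridging _)       c = c
Crosses-sym (peripheral _ _ _) (peripheral _ _ _) c = swap c

-- Marked points in the universal cover

module Cover (n′ : ℕ) where

  open Residues n′

  π : ℕ → Fin n
  π x = x mod n

  toℕ-π : ∀ x → toℕ (π x) ≡ x % n
  toℕ-π x = Fin.toℕ-fromℕ< _

  π-cong : ∀ x y → x % n ≡ y % n → π x ≡ π y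
  π-cong x y eq = Fin.toℕ-injective (trans (toℕ-π x) (trans eq (sym (toℕ-π y))))

  toℕ-% : (i : Fin n) → toℕ i % n ≡ toℕ i
  toℕ-% i = m<n⇒m%n≡m (Fin.toℕ<n i)

  π-toℕ : ∀ i → π (toℕ i) ≡ i
  π-toℕ i = Fin.toℕ-injective (trans (toℕ-π (toℕ i)) (toℕ-% i))

  π≡ : ∀ x i → x % n ≡ toℕ i % n → π x ≡ i
  π≡ x i eq = trans (π-cong x (toℕ i) eq) (π-toℕ i)

  cw-< : ∀ {i j : Fin n} → toℕ i < toℕ j → cw i j ≡ toℕ j ∸ toℕ i
  cw-< {i} {j} i<j with toℕ i <ᵇ toℕ j | <⇒<ᵇ i<j
  ... | true | _ = refl

  cw-≥ : ∀ {i j : Fin n} → toℕ j ≤ toℕ i → cw i j ≡ n + toℕ j ∸ toℕ i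
  cw-≥ {i} {j} j≤i with toℕ i <ᵇ toℕ j | <ᵇ⇒< (toℕ i) (toℕ j)
  ... | true  | f = contradiction (f _) (≤⇒≯ j≤i)
  ... | false | _ = refl

  1≤cw : ∀ (i j : Fin n) → 1 ≤ cw i j
  1≤cw i j with toℕ i <? toℕ j
  ... | yes i<j = subst (1 ≤_) (sym (cw-< i<j)) (m<n⇒0<n∸m i<j)
  ... | no i≮j  = subst (1 ≤_) (sym (cw-≥ (≮⇒≥ i≮j)))
    (m<n⇒0<n∸m (<-≤-trans (Fin.toℕ<n i) (m≤m+n n (toℕ j))))

  cw≤n : ∀ (i j : Fin n) → cw i j ≤ n
  cw≤n i j with toℕ i <? toℕ j
  ... | yes i<j = subst (_≤ n) (sym (cw-< i<j)) (≤-trans (m∸n≤m (toℕ j) (toℕ i)) (<⇒≤ (Fin.toℕ<n j)))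
  ... | no i≮j  = subst (_≤ n) (sym (cw-≥ (≮⇒≥ i≮j)))
    (≤-trans (∸-monoʳ-≤ (n + toℕ j) (≮⇒≥ i≮j)) (≤-reflexive (m+n∸n≡m n (toℕ j))))

  +-cw-% : ∀ (i j : Fin n) → (toℕ i + cw i j) % n ≡ toℕ j % n
  +-cw-% i j with toℕ i <? toℕ j
  ... | yes i<j = cong (_% n) (trans (cong (_+_ (toℕ i)) (cw-< i<j)) (m+[n∸m]≡n (<⇒≤ i<j)))
  ... | no i≮j  = trans (cong (_% n)
    (trans (cong (_+_ (toℕ i)) (cw-≥ (≮⇒≥ i≮j)))
      (trans (m+[n∸m]≡n (≤-trans (<⇒≤ (Fin.toℕ<n i)) (m≤m+n n (toℕ j)))) (+-comm n (toℕ j)))))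
    ([m+n]%n≡m%n (toℕ j) n)

  π-%  : ∀ x → x % n ≡ toℕ (π x) % n
  π-% x = trans (sym (m%n%n≡m%n x n)) (cong (_% n) (sym (toℕ-π x)))

  -- Both sides lie between 1 and `n` and are congruent modulo `n`. At `y = x + n` this is the full
  -- turn, where `cw` is `n` and not 0.
  cw-π : ∀ {x y} → x < y → y ≤ x + n → cw (π x) (π y) ≡ y ∸ x
  cw-π {x} {y} x<y y≤x+n = unique (1≤cw (π x) (π y)) (m<n⇒0<n∸m x<y) (cw≤n (π x) (π y))
    (≤-trans (∸-monoˡ-≤ x y≤x+n) (≤-reflexive (m+n∸m≡n x n))) same
    where
    unique : ∀ {c l} → 1 ≤ c → 1 ≤ l → c ≤ n → l ≤ n → c % n ≡ l % n → c ≡ l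
    unique {suc c} {suc l} _ _ (s≤s c≤n′) (s≤s l≤n′) eq = cong suc (begin
      c     ≡⟨ m≤n⇒m%n≡m c≤n′ ⟨
      c % n ≡⟨ +-cancelʳ-% c l {1} (s≤s z≤n) (trans (cong (_% n) (+-comm c 1))
                 (trans eq (cong (_% n) (+-comm 1 l)))) ⟩
      l % n ≡⟨ m≤n⇒m%n≡m l≤n′ ⟩
      l     ∎)
      where open ≡-Reasoning
    c l i : ℕ
    c = cw (π x) (π y)
    l = y ∸ x
    i = toℕ (π x)
    same : c % n ≡ l % n
    same = +-cancelʳ-% c l {i} (<⇒≤ (Fin.toℕ<n (π x))) (begin
      (c + i) % n     ≡⟨ cong (_% n) (+-comm c i) ⟩
      (i + c) % n     ≡⟨ +-cw-% (π x) (π y) ⟩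
      toℕ (π y) % n   ≡⟨ π-% y ⟨
      y % n           ≡⟨ cong (_% n) (m+[n∸m]≡n (<⇒≤ x<y)) ⟨
      (x + l) % n     ≡⟨ +-congʳ-% x i l (π-% x) ⟩
      (i + l) % n     ≡⟨ cong (_% n) (+-comm i l) ⟩
      (l + i) % n     ∎)
      where open ≡-Reasoning

  lift-after : ∀ x j → ∃ λ y → x < y × y ≤ x + n × π y ≡ j
  lift-after x j = x + c , m<m+n x (1≤cw (π x) j) , +-monoʳ-≤ x (cw≤n (π x) j) ,
    π≡ (x + c) j (trans (+-congʳ-% x (toℕ (π x)) c (π-% x)) (+-cw-% (π x) j))
    where c = cw (π x) j

  -- The cover is modelled on the naturals, so moving left needs room: `n ≤ y` makes a whole turn
  -- available.
  lift-before : ∀ {y} → n ≤ y → ∀ i → ∃ λ x → x < y × y ≤ x + n × π x ≡ i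
  lift-before {y} n≤y i = y ∸ c , ∸-monoʳ-< (1≤cw i (π y)) c≤y ,
    ≤-trans (≤-reflexive (sym y∸c+c)) (+-monoʳ-≤ (y ∸ c) (cw≤n i (π y))) ,
    π≡ (y ∸ c) i (+-cancelʳ-% (y ∸ c) (toℕ i) (cw≤n i (π y))
      (trans (cong (_% n) y∸c+c) (trans (π-% y) (sym (+-cw-% i (π y))))))
    where
    c = cw i (π y)
    c≤y : c ≤ y
    c≤y = ≤-trans (cw≤n i (π y)) n≤y
    y∸c+c : y ∸ c + c ≡ y
    y∸c+c = m∸n+n≡m c≤y

  cw-self : ∀ (i : Fin n) → cw i i ≡ n
  cw-self i = trans (cw-≥ {i} {i} ≤-refl) (m+n∸n≡m n (toℕ i))

-- Chords, edges and triangles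

module Triangulation (n′ : ℕ) (Π : List (Arc (suc n′))) (T : IsTriangulation Π) where

  open Residues n′
  open Cover n′
  open IsTriangulation T
  open DecMembership (_≟ᴬ_ {n}) using (_∈?_)

  uncrossed⇒∈ : ∀ γ → ¬ Crosses γ γ → (∀ {β} → β ∈ Π → ¬ Crosses γ β) → γ ∈ Π
  uncrossed⇒∈ γ ¬γγ ¬γΠ = maximal nc there (here refl)
    where
    nc : NonCrossing (γ ∷ Π)
    nc (here refl) (here refl) = ¬γγ
    nc (here refl) (there β∈Π) = ¬γΠ β∈Π
    nc {α} (there α∈Π) (here refl) c = ¬γΠ α∈Π (Crosses-sym α γ c)
    nc (there α∈Π) (there β∈Π) = nonCrossing α∈Π β∈Π

  Bridge : ℕ → Set
  Bridge x = bridging (π x) ∈ Π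

  -- The bounds single out genuine lifts: with them `y ∸ x` is the arc's length by `cw-π`, whereas
  -- `π` alone forgets the number of turns.
  Chord : ℕ → ℕ → Set
  Chord x y = x < y × y ≤ x + n ×
    Σ (2 ≤ cw (π x) (π y)) λ p → peripheral (π x) (π y) p ∈ Π

  Edge : ℕ → ℕ → Set
  Edge x y = y ≡ suc x ⊎ Chord x y

  chord? : ∀ x y → Dec (Chord x y)
  chord? x y = x <? y ×-dec y ≤? x + n ×-dec member
    where
    member : Dec (Σ (2 ≤ cw (π x) (π y)) λ p → peripheral (π x) (π y) p ∈ Π)
    member with 2 ≤? cw (π x) (π y)
    ... | no ¬p = no λ (p , _) → ¬p p
    ... | yes p = map′ (p ,_) proj₂ (peripheral (π x) (π y) p ∈? Π)

  edge? : ∀ x y → Dec (Edge x y)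
  edge? x y = y ≟ suc x ⊎-dec chord? x y

  chords-noncrossing : ∀ {a b c d} → Chord a b → Chord c d → a < c → c < b → b < d → ⊥
  chords-noncrossing {a} {b} {c} {d} (a<b , b≤ , _ , ab∈) (c<d , d≤ , _ , cd∈) a<c c<b b<d =
    nonCrossing ab∈ cd∈ (inj₁
      ( subst₂ _<_ (sym ac) (sym ab) (∸-monoˡ-< c<b (<⇒≤ a<c))
      , subst₂ _<_ (sym ab) (sym (trans (cong₂ _+_ ac (cw-π c<d d≤)) (∸-telescope (<⇒≤ a<c) (<⇒≤ c<d))))
          (∸-monoˡ-< b<d (<⇒≤ a<b)) ))
    where
    ab : cw (π a) (π b) ≡ b ∸ a
    ab = cw-π a<b b≤
    ac : cw (π a) (π c) ≡ c ∸ a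
    ac = cw-π a<c (≤-trans (<⇒≤ c<b) b≤)

  chord-bridge-noncrossing : ∀ {a b m} → Chord a b → Bridge m → a < m → m < b → ⊥
  chord-bridge-noncrossing {a} {b} {m} (a<b , b≤ , _ , ab∈) m∈ a<m m<b = nonCrossing ab∈ m∈
    (subst₂ _<_ (sym (cw-π a<m (≤-trans (<⇒≤ m<b) b≤))) (sym (cw-π a<b b≤))
      (∸-monoˡ-< m<b (<⇒≤ a<m)))

  -- By maximality it suffices that no arc of `Π` crosses the chord. A crossing is realised by a
  -- lift starting after `x`, or by one starting before `x`, for which `n ≤ x` is needed.
  uncrossed⇒edge : ∀ {x y} → n ≤ x → x < y → y ≤ x + n →
    (∀ {c d} → Chord c d → c < x → x < d → d < y → ⊥) →
    (∀ {c d} → Chord c d → x < c → c < y → y < d → ⊥) →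
    (∀ {m} → Bridge m → x < m → m < y → ⊥) →
    Edge x y
  uncrossed⇒edge {x} {y} n≤x x<y y≤ left right radial with y ≟ suc x
  ... | yes eq = inj₁ eq
  ... | no neq = inj₂ (x<y , y≤ , p , uncrossed⇒∈ γ ¬γγ ¬γΠ)
    where
    xy : cw (π x) (π y) ≡ y ∸ x
    xy = cw-π x<y y≤

    p : 2 ≤ cw (π x) (π y)
    p = subst (2 ≤_) (sym xy) (m+n≤o⇒m≤o∸n 2 (≤∧≢⇒< x<y (λ eq → neq (sym eq))))

    γ : Arc n
    γ = peripheral (π x) (π y) p

    ¬γγ : ¬ Crosses γ γ
    -- A self-crossing would make the full turn `cw i i`, of length `n`, shorter than `cw i j`.
    ¬γγ (inj₁ (h , _)) = ≤⇒≯ (cw≤n (π x) (π y)) (subst (_< cw (π x) (π y)) (cw-self (π x)) h)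
    ¬γγ (inj₂ (h , _)) = ≤⇒≯ (cw≤n (π x) (π y)) (subst (_< cw (π x) (π y)) (cw-self (π x)) h)

    ¬γΠ : ∀ {β} → β ∈ Π → ¬ Crosses γ β
    ¬γΠ {bridging k} β∈ h with lift-after x k
    ... | m , x<m , m≤ , refl =
      radial β∈ x<m (∸-reflect-< x (subst₂ _<_ (cw-π x<m m≤) xy h))
    ¬γΠ {peripheral i j q} β∈ (inj₁ (h₁ , h₂)) with lift-after x i
    ... | c , x<c , c≤ , refl with lift-after c j
    ... | d , c<d , d≤ , refl =
      right (c<d , d≤ , recompute (2 ≤? _) q , β∈) x<c
        (∸-reflect-< x (subst₂ _<_ xc xy h₁))
        (∸-reflect-< x (subst₂ _<_ xy
          (trans (cong₂ _+_ xc (cw-π c<d d≤)) (∸-telescope (<⇒≤ x<c) (<⇒≤ c<d))) h₂))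
      where
      xc : cw (π x) (π c) ≡ c ∸ x
      xc = cw-π x<c c≤
    ¬γΠ {peripheral i j q} β∈ (inj₂ (h₁ , h₂)) with lift-before n≤x i
    ... | c , c<x , x≤ , refl with lift-after c j
    ... | d , c<d , d≤ , refl =
      left (c<d , d≤ , recompute (2 ≤? _) q , β∈) c<x
        (∸-reflect-< c (subst₂ _<_ cx cd h₁))
        (∸-reflect-< c (subst₂ _<_ cd
          (trans (cong₂ _+_ cx xy) (∸-telescope (<⇒≤ c<x) (<⇒≤ x<y))) h₂))
      where
      cx : cw (π c) (π x) ≡ x ∸ c
      cx = cw-π c<x x≤
      cd : cw (π c) (π d) ≡ d ∸ c
      cd = cw-π c<d d≤

  chord-long : ∀ {x y} → Chord x (suc y) → x < y
  chord-long {x} (x<y , y≤ , p , _) =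
    s≤s⁻¹ (subst (2 + x ≤_) (m∸n+n≡m (<⇒≤ x<y)) (+-monoˡ-≤ x (subst (2 ≤_) (cw-π x<y y≤) p)))

  -- Take the leftmost `k` after `x` with an edge to the right end; the boundary segment there
  -- ensures that one exists. Anything crossing `x k` would cross `x y` or the edge from `k`, or
  -- contradict the choice of `k`.
  third-vertex : ∀ {x y} → n ≤ x → Chord x y →
    ∃ λ k → x < k × k < y × Edge x k × Edge k y
  third-vertex {x} {suc y} n≤x xy@(_ , y≤ , _)
    with k , x<k , k≤y , ky , min ← least (λ k → edge? k (suc y)) (y ∸ suc x) (suc x)
           (inj₁ (cong suc (sym (m∸n+n≡m (chord-long xy))))) =
    k , x<k , k<1+y k≤y , uncrossed⇒edge n≤x x<k (≤-trans (<⇒≤ (k<1+y k≤y)) y≤)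
      (λ cd c<x x<d d<k → chords-noncrossing cd xy c<x x<d (<-trans d<k (k<1+y k≤y)))
      (right ky (k<1+y k≤y) min)
      (λ m∈ x<m m<k → chord-bridge-noncrossing xy m∈ x<m (<-trans m<k (k<1+y k≤y))) , ky
    where
    k<1+y : ∀ {k} → k ≤ y ∸ suc x + suc x → k < suc y
    k<1+y {k} h = s≤s (subst (k ≤_) (m∸n+n≡m (chord-long xy)) h)

    right : ∀ {k c d} → Edge k (suc y) → k < suc y →
      (∀ {j} → suc x ≤ j → j < k → ¬ Edge j (suc y)) →
      Chord c d → x < c → c < k → k < d → ⊥
    -- If `d` lies beyond the right end, `c d` crosses the given chord; if it is the right end, `c`
    -- contradicts minimality; otherwise `d` lies strictly below the edge from `k`, so that edge is
    -- a chord and is crossed.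
    right {k} {c} {d} ky k<y min cd x<c c<k k<d with <-cmp d (suc y)
    ... | tri> _ _ y<d  = chords-noncrossing xy cd x<c (<-trans c<k k<y) y<d
    ... | tri≈ _ refl _ = min x<c c<k (inj₂ cd)
    ... | tri< d<y _ _ with ky
    ...   | inj₁ refl = <⇒≱ d<y k<d
    ...   | inj₂ ky′  = chords-noncrossing cd ky′ c<k k<d d<y

  -- Counting arcs at a vertex

  -- If x is an endpoint of a chord of length l, the arcs counted are, by
  -- noncrossing, the chord itself and the other arcs at x below it.
  starts finishes : ℕ → ℕ → ℕ
  starts x l   = sum (map (startsIn (π x) l) Π)
  finishes y l = sum (map (endsIn (π y) l) Π)

  a : ℕ → ℕ
  a x = quiddity Π (π x)

  -- The chord itself is counted at its own length but not at a smaller cutoff.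
  starts-< : ∀ {x y l} → Chord x y → l < y ∸ x → starts x l < starts x (y ∸ x)
  starts-< {x} {y} {l} (x<y , y≤ , p , xy∈) l<len =
    sum-mono-< (startsIn-mono (π x) (<⇒≤ l<len)) xy∈
      (subst₂ _<_ (sym (capped-> _ (subst (l <_) (sym len) l<len)))
        (sym (trans (capped-≤ _ (≤-reflexive len)) (δ-refl (π x)))) (s≤s z≤n))
    where
    len : cw (π x) (π y) ≡ y ∸ x
    len = cw-π x<y y≤

  finishes-< : ∀ {x y l} → Chord x y → l < y ∸ x → finishes y l < finishes y (y ∸ x)
  finishes-< {x} {y} {l} (x<y , y≤ , p , xy∈) l<len =
    sum-mono-< (endsIn-mono (π y) (<⇒≤ l<len)) xy∈
      (subst₂ _<_ (sym (capped-> _ (subst (l <_) (sym len) l<len)))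
        (sym (trans (capped-≤ _ (≤-reflexive len)) (δ-refl (π y)))) (s≤s z≤n))
    where
    len : cw (π x) (π y) ≡ y ∸ x
    len = cw-π x<y y≤

  -- Strictness comes from the `suc` in `quiddity`: there is one more component than arc ends.
  starts+finishes<a : ∀ x l m → starts x l + finishes x m < a x
  starts+finishes<a x l m = s≤s (≤-trans (≤-reflexive (sum-map-+ (startsIn (π x) l) (endsIn (π x) m) Π))
    (sum-mono-≤ (startsIn+endsIn≤ends (π x) l m) Π))

  -- The bridging arc at `x` has an end there that neither count sees.
  bridge⇒1+starts+finishes<a : ∀ x l m → Bridge x → suc (starts x l + finishes x m) < a x
  bridge⇒1+starts+finishes<a x l m x∈ =
    s≤s (≤-trans (s≤s (≤-reflexive (sum-map-+ (startsIn (π x) l) (endsIn (π x) m) Π)))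
      (sum-mono-< (startsIn+endsIn≤ends (π x) l m) x∈ (subst (0 <_) (sym (δ-refl (π x))) (s≤s z≤n))))

  -- Labelling below an edge

  -- The third vertex gets the value `A + B` and both lower edges are treated recursively, with `N`
  -- as fuel. In the bounds, each arc counted at an end allows one more copy of that end's value in
  -- the neighbouring value.
  edge-path : ∀ N {x y} → y ≤ N + x → n ≤ x → Edge x y → ∀ A B → 0 < A → 0 < B →
    ∃₂ λ A′ B′ → Path a x A A′ y B′ B ×
      A′ ≤ B + starts x (y ∸ x) * A × B′ ≤ A + finishes y (y ∸ x) * B
  edge-path N _ n≤x (inj₁ refl) A B A>0 B>0 =
    B , A , edge A>0 B>0 , m≤m+n B _ , m≤m+n A _
  edge-path zero    y≤ n≤x (inj₂ (x<y , _)) = contradiction y≤ (<⇒≱ x<y)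
  edge-path (suc N) {x} {y} y≤ n≤x (inj₂ xy) A B A>0 B>0
    with k , x<k , k<y , xk , ky ← third-vertex n≤x xy
    with A′ , P , p , A′≤ , P≤ ← edge-path N (s≤s⁻¹ (<-≤-trans k<y y≤)) n≤x xk A (A + B)
           A>0 (≤-trans A>0 (m≤m+n A B))
    with Q , B′ , q , Q≤ , B′≤ ← edge-path N
           (≤-trans y≤ (≤-trans (≤-reflexive (sym (+-suc N x))) (+-monoʳ-≤ N x<k)))
           (≤-trans n≤x (<⇒≤ x<k)) ky (A + B) B (≤-trans A>0 (m≤m+n A B)) B>0 =
    A′ , B′ , glue p q P+Q≤ , A′≤′ , B′≤′
    where
    M S F : ℕ
    M = A + B
    S = starts k (y ∸ k)
    F = finishes k (k ∸ x)

    -- The summands `A` and `B` left over from the two bounds make one more copy of `M`, paid for by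
    -- the strictness of `starts+finishes<a`.
    P+Q≤ : P + Q ≤ a k * M
    P+Q≤ = begin
      P + Q                       ≤⟨ +-mono-≤ P≤ Q≤ ⟩
      (A + F * M) + (B + S * M)   ≡⟨ collect A B F S ⟩
      suc (S + F) * M             ≤⟨ *-monoˡ-≤ M (starts+finishes<a k (y ∸ k) (k ∸ x)) ⟩
      a k * M                     ∎
      where
      open ≤-Reasoning
      collect : ∀ A B F S → (A + F * (A + B)) + (B + S * (A + B)) ≡ suc (S + F) * (A + B)
      collect = solve-∀

    -- Raising the cutoff from the length of `x k` to that of `x y` counts at least one more arc,
    -- which absorbs the `A` in `A + B`.
    A′≤′ : A′ ≤ B + starts x (y ∸ x) * A
    A′≤′ = begin
      A′                            ≤⟨ A′≤ ⟩
      A + B + starts x (k ∸ x) * A  ≡⟨ collect A B (starts x (k ∸ x)) ⟩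
      B + suc (starts x (k ∸ x)) * A
        ≤⟨ +-monoʳ-≤ B (*-monoˡ-≤ A (starts-< xy (∸-monoˡ-< k<y (<⇒≤ x<k)))) ⟩
      B + starts x (y ∸ x) * A      ∎
      where
      open ≤-Reasoning
      collect : ∀ A B s → A + B + s * A ≡ B + suc s * A
      collect = solve-∀

    B′≤′ : B′ ≤ A + finishes y (y ∸ x) * B
    B′≤′ = begin
      B′                              ≤⟨ B′≤ ⟩
      A + B + finishes y (y ∸ k) * B  ≡⟨ collect A B (finishes y (y ∸ k)) ⟩
      A + suc (finishes y (y ∸ k)) * B
        ≤⟨ +-monoʳ-≤ A (*-monoˡ-≤ B (finishes-< xy (∸-monoʳ-< x<k (<⇒≤ k<y)))) ⟩
      A + finishes y (y ∸ x) * B      ∎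
      where
      open ≤-Reasoning
      collect : ∀ A B s → A + B + s * B ≡ A + suc s * B
      collect = solve-∀

  -- Bridging arcs and paths between them

  length : Arc n → ℕ
  length (bridging _)       = 0
  length (peripheral i j _) = cw i j

  origin : Arc n → Fin n
  origin (bridging i)       = i
  origin (peripheral i _ _) = i

  -- An arc crossing the ray from the origin of a longest arc would have to
  -- be longer than it, or cross it.
  exists-bridging : ∃ λ k → bridging k ∈ Π
  exists-bridging = origin longest , uncrossed⇒∈ (bridging (origin longest)) (λ ()) uncrossed
    where
    longest : Arc n
    -- The default has length 0, so it cannot be longest once `Π` contains a peripheral arc.
    longest = argmax length (bridging Fin.zero) Π

    is-longest : ∀ {β} → β ∈ Π → length β ≤ length longest
    is-longest = All.lookup (f[xs]≤f[argmax] (bridging Fin.zero) Π)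

    uncrossed : ∀ {β} → β ∈ Π → ¬ Crosses (bridging (origin longest)) β
    uncrossed {peripheral c d _} β∈ h
      with longest | is-longest β∈ | argmax-sel length (bridging Fin.zero) Π
    ... | bridging k       | cd≤ | _         = <⇒≱ (1≤cw c d) cd≤
    ... | peripheral i j _ | cd≤ | inj₂ α∈   =
      nonCrossing β∈ α∈ (inj₁ (h , ≤-<-trans cd≤ (m<n+m (cw i j) (1≤cw c i))))

  n′+1+p≡p+n : ∀ p → n′ + suc p ≡ p + n
  n′+1+p≡p+n p = trans (+-suc n′ p) (+-comm n p)

  -- The search stops at `p + n` at the latest, over the same marked point. A chord crossing `p q`
  -- would pass over `p` or `q` and so cross a bridging arc; minimality excludes rays in between.
  next-bridge : ∀ {p} → n ≤ p → Bridge p → ∃ λ q → p < q × Bridge q × Edge p q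
  next-bridge {p} n≤p p∈
    with q , p<q , q≤ , q∈ , min ← least (λ x → bridging (π x) ∈? Π) n′ (suc p)
           (subst (λ i → bridging i ∈ Π) (sym (π-cong (n′ + suc p) p
             (trans (cong (_% n) (n′+1+p≡p+n p)) ([m+n]%n≡m%n p n)))) p∈) =
    q , p<q , q∈ , uncrossed⇒edge n≤p p<q (subst (q ≤_) (n′+1+p≡p+n p) q≤)
      (λ cd c<p p<d _ → chord-bridge-noncrossing cd p∈ c<p p<d)
      (λ cd _ c<q q<d → chord-bridge-noncrossing cd q∈ c<q q<d)
      (λ m∈ p<m m<q → min p<m m<q m∈)

  -- Successive bridging vertices all get the value 1, and each step gains at least one position.
  -- The bound on `B′` is kept for the next gluing.
  bridge-path : ∀ {p} → n ≤ p → Bridge p → ∀ N → ∃ λ q → N + p < q × Bridge q ×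
    ∃₂ λ A′ B′ → Path a p 1 A′ q B′ 1 × ∃ λ l → B′ ≤ 1 + finishes q l * 1
  bridge-path {p} n≤p p∈ zero with q , p<q , q∈ , pq ← next-bridge n≤p p∈
    with A′ , B′ , path , _ , B′≤ ← edge-path q (m≤m+n q p) n≤p pq 1 1 (s≤s z≤n) (s≤s z≤n) =
    q , p<q , q∈ , A′ , B′ , path , q ∸ p , B′≤
  bridge-path {p} n≤p p∈ (suc N)
    with q , N+p<q , q∈ , A′ , B′ , path , l , B′≤ ← bridge-path n≤p p∈ N
    with n≤q ← ≤-trans n≤p (≤-trans (m≤n+m p N) (<⇒≤ N+p<q))
    with r , q<r , r∈ , qr ← next-bridge n≤q q∈
    with C , D , path′ , C≤ , D≤ ← edge-path r (m≤m+n r q) n≤q qr 1 1 (s≤s z≤n) (s≤s z≤n) =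
    r , ≤-<-trans N+p<q q<r , r∈ , A′ , D , glue path path′ B′+C≤ , r ∸ q , D≤
    where
    S F : ℕ
    S = starts q (r ∸ q)
    F = finishes q l

    -- The two units come from the values 1 at the neighbouring bridging vertices; the bridging arc
    -- at `q` pays for the second.
    B′+C≤ : B′ + C ≤ a q * 1
    B′+C≤ = begin
      B′ + C                    ≤⟨ +-mono-≤ B′≤ C≤ ⟩
      (1 + F * 1) + (1 + S * 1) ≡⟨ collect F S ⟩
      suc (suc (S + F)) * 1     ≤⟨ *-monoˡ-≤ 1 (bridge⇒1+starts+finishes<a q (r ∸ q) l q∈) ⟩
      a q * 1                   ∎
      where
      open ≤-Reasoning
      collect : ∀ F S → (1 + F * 1) + (1 + S * 1) ≡ suc (suc (S + F)) * 1
      collect = solve-∀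

  -- Positivity of the frieze

  -- A long path from a bridging vertex loses its initial piece up to `x`. The lift `toℕ k + n` is
  -- at least `n`, as `bridge-path` requires, and at most `n′ + n`, hence at most `x`.
  path-across : ∀ x y → n′ + n ≤ x → ∃ λ z → y < z × ∃₂ λ A A′ → ∃₂ λ B′ B → Path a x A A′ z B′ B
  path-across x y n′+n≤x
    with k , k∈ ← exists-bridging
    with p≤x ← ≤-trans (+-monoˡ-≤ n (s≤s⁻¹ (Fin.toℕ<n k))) n′+n≤x
    with z , x+y+p<z , _ , _ , B′ , path , _ ← bridge-path (m≤n+m n (toℕ k))
           (subst (λ i → bridging i ∈ Π)
             (trans (sym (π-toℕ k)) (π-cong (toℕ k) (toℕ k + n) (sym ([m+n]%n≡m%n (toℕ k) n)))) k∈)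
           (x + y)
    with A , A′ , path′ ← drop {a} (x ∸ (toℕ k + n))
           (≤-<-trans (≤-trans (≤-reflexive (m∸n+n≡m p≤x)) (≤-trans (m≤m+n x y) (m≤m+n (x + y) _))) x+y+p<z) path =
    z , ≤-<-trans (≤-trans (m≤n+m y x) (m≤m+n (x + y) _)) x+y+p<z ,
    A , A′ , B′ , 1 , subst (λ w → Path a w A A′ z B′ 1) (m∸n+n≡m p≤x) path′

  a-cong : ∀ r s → r % n ≡ s % n → a r ≡ a s
  a-cong r s eq = cong (quiddity Π) (π-cong r s eq)

  open Continuant a using (U; U-positive)
  open PeriodicFrieze n′ a a-cong

  -- By periodicity row `r` may be moved two turns to the right, to `suc (r + (n′ + n))`, which
  -- leaves the room on the left that `path-across` requires.
  U>0 : ∀ r t → 0ℤ ℤ.< U r (suc t)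
  U>0 r t with z , x+1+t<z , _ , _ , _ , _ , path ← path-across (r + (n′ + n)) (r + (n′ + n) + suc t)
                 (m≤n+m (n′ + n) r) =
    subst (0ℤ ℤ.<_) (U-cong (suc (r + (n′ + n))) r (suc t) two-turns)
      (U-positive path t (<⇒≤ x+1+t<z))
    where
    shift : ∀ r n′ → suc (r + (n′ + suc n′)) ≡ r + 2 * suc n′
    shift = solve-∀
    two-turns : suc (r + (n′ + n)) % n ≡ r % n
    two-turns = trans (cong (_% n) (shift r n′)) ([m+kn]%n≡m%n r 2 n)

  theorem : ∃ λ m → IsInfiniteFrieze m × IsPeriodic n m ×
    ((i : Fin n) → m (label i) (label i) ≡ + quiddity Π i)
  theorem = frieze , frieze-isFrieze U>0 , frieze-periodic , λ i →
    trans (frieze-diag (toℕ i)) (cong (λ j → + quiddity Π j) (π-toℕ i))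

theorem3p6 : (n : ℕ) → 1 ≤ n → (Π : List (Arc n)) → IsTriangulation Π →
    ∃ λ (m : ℤ → ℤ → ℤ) → IsInfiniteFrieze m × IsPeriodic n m ×
    ((i : Fin n) → m (label i) (label i) ≡ + quiddity Π i)
theorem3p6 (suc n′) _ Π T = Triangulation.theorem n′ Π T
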